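{- Let $m,n\ge 2$ be integers. The $2$-capture time of the $m\times n$ grid (the Cartesian product $P_m\square P_n$ of a path with $m$ vertices and a path with $n$ vertices) is equal to $$\left\lfloor \frac{m+n}{2}\right\rfloor - 1 .$$
   Context: The Cartesian product $G\square H$ has vertex set $V(G)\times V(H)$, with $(u_1,v_1)$ and $(u_2,v_2)$ adjacent iff either $u_1=u_2$ and $v_1v_2\in E(H)$, or $v_1=v_2$ and $u_1u_2\in E(G)$. Cops and Robber game with $k$ cops on a finite simple connected graph $G$: players occupy vertices, and several players may occupy the same vertex. In round 0, first each of the $k$ cops chooses a starting vertex, then the robber chooses a starting vertex. In each subsequent round $1,2,\dots$, first each cop moves and then the robber moves; a move of a player consists of staying or going to an adjacent vertex. All positions are known to all players at all times. The game ends and the cops win (the robber is captured) as soon as the robber is at a vertex occupied by some cop. (Letting the robber move before the cops in each round after round 0 does not change the values below, and the paper adopts that convention.) The length of a game is $t$ if the robber is captured in round $t$, and infinite if she is never captured. The $k$-capture time $\operatorname{capt}_k(G)$ is the length of an optimal game: the least $t$ such that $k$ cops have a strategy (including the choice of starting vertices) guaranteeing capture in round at most $t$, whatever the robber does (infinite if there is no such $t$). -}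

module Defs where

open import Data.Fin using (Fin; toℕ)
open import Data.List.NonEmpty using (List⁺; [_]; _∷⁺_; head)
open import Data.Nat using (ℕ; zero; suc; _≤_)
open import Data.Nat.Properties using (1+n≢n)
open import Data.Product using (_×_; _,_; proj₁; proj₂; Σ-syntax; ∃-syntax)
open import Data.Sum using (_⊎_; inj₁; inj₂; swap)
open import Data.Vec.Functional using (Vector)
open import Relation.Binary.Definitions using (Symmetric)
open import Relation.Binary.PropositionalEquality using (_≡_; refl; sym)
open import Relation.Nullary using (¬_)

record SimpleGraph : Set₁ where
  field
    Vertex     : Set
    Adj        : Vertex → Vertex → Set
    Adj-sym    : Symmetric Adj
    Adj-irrefl : ∀ {v} → ¬ Adj v v

open SimpleGraph

Path : ℕ → SimpleGraph
Path n .Vertex  = Fin n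
Path n .Adj i j = toℕ j ≡ suc (toℕ i) ⊎ toℕ i ≡ suc (toℕ j)
Path n .Adj-sym = swap
Path n .Adj-irrefl (inj₁ e) = 1+n≢n (sym e)
Path n .Adj-irrefl (inj₂ e) = 1+n≢n (sym e)

infixr 7 _□_

_□_ : SimpleGraph → SimpleGraph → SimpleGraph
(G □ H) .Vertex = Vertex G × Vertex H
(G □ H) .Adj (u₁ , v₁) (u₂ , v₂) =
  (u₁ ≡ u₂ × Adj H v₁ v₂) ⊎ (v₁ ≡ v₂ × Adj G u₁ u₂)
(G □ H) .Adj-sym (inj₁ (e , a)) = inj₁ (sym e , Adj-sym H a)
(G □ H) .Adj-sym (inj₂ (e , a)) = inj₂ (sym e , Adj-sym G a)
(G □ H) .Adj-irrefl (inj₁ (_ , a)) = Adj-irrefl H a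
(G □ H) .Adj-irrefl (inj₂ (_ , a)) = Adj-irrefl G a

module CopsAndRobber (G : SimpleGraph) (k : ℕ) where

  Cops : Set
  Cops = Vector (Vertex G) k

  Robber : Set
  Robber = Vertex G

  Move : Vertex G → Vertex G → Set
  Move u v = u ≡ v ⊎ Adj G u v

  -- The positions at the ends of rounds t, t-1, …, 0, the most recent first.
  History : Set
  History = List⁺ (Cops × Robber)

  cops : History → Cops
  cops h = proj₁ (head h)

  robber : History → Robber
  robber h = proj₂ (head h)

  record CopStrategy : Set where
    field
      start : Cops
      next  : History → Cops
      legal : ∀ h i → Move (cops h i) (next h i)

  -- The robber answers the cops' placement and, in each later round, the
  -- cops' move of that same round.
  record RobberStrategy : Set where
    field
      start : Cops → Robber
      next  : History → Cops → Robber
      legal : ∀ h c → Move (robber h) (next h c)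

  Caught : Cops → Robber → Set
  Caught c r = ∃[ i ] c i ≡ r

  module _ (σ : CopStrategy) (ρ : RobberStrategy) where
    private
      module σ = CopStrategy σ
      module ρ = RobberStrategy ρ

    -- Play is continued formally after a capture; only the first round with a
    -- capture matters, so what happens afterwards has no effect below.
    play : ℕ → History
    play zero    = [ σ.start , ρ.start σ.start ]
    play (suc t) = (c , ρ.next h c) ∷⁺ h
      where
      h = play t
      c = σ.next h

    -- The robber can be caught by the cops' move (she is then still where she
    -- was at the end of the previous round) or by her own move onto a cop.
    CapturedInRound : ℕ → Set
    CapturedInRound zero    = Caught (cops (play zero)) (robber (play zero))
    CapturedInRound (suc t) =
      Caught (cops (play (suc t))) (robber (play t)) ⊎
      Caught (cops (play (suc t))) (robber (play (suc t)))

  CopsWinWithin : ℕ → Set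
  CopsWinWithin t =
    Σ[ σ ∈ CopStrategy ] (∀ (ρ : RobberStrategy) →
      ∃[ s ] s ≤ t × CapturedInRound σ ρ s)

-- A relation rather than a function, since the capture time may be infinite.
IsCaptureTime : SimpleGraph → ℕ → ℕ → Set
IsCaptureTime G k t = CopsWinWithin t × (∀ s → CopsWinWithin s → t ≤ s)
  where open CopsAndRobber G k

{-# OPTIONS --safe #-}

-- Measured along the diagonals, u = x + y and v = x + (N − y) (for coordinates
-- x ≤ M, y ≤ N), every step along an edge changes both u and v by exactly one,
-- with an independent choice of the two signs.  So pursuit splits into two
-- one-dimensional chases on [0, M + N].
--
-- Cops: two adjacent cops start in the centre, and each steps towards the robber
-- in both u and v (either way in a coordinate where he already agrees with her).
-- As long as the robber is on the same side of both cops in u, both keep moving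
-- that way, which can last for only half of M + N rounds; after that one of the
-- cops agrees with her in u, and likewise in v.  By the parity of u + v it is the
-- same cop, and he has caught her.
--
-- Robber: suppose 2s + 2 ≤ M + N, and consider two opposite corners.  If both
-- cops are more than s away from one of them, she waits there.  Otherwise each
-- corner has its own cop, and at one of the corners the other cop is too far
-- away to interfere; there she circles on the corner 4-cycle, staying opposite
-- to the retraction of the near cop onto it.
module Submission where

open import Data.Empty using (⊥-elim)
open import Data.Fin using (Fin; zero; suc; toℕ; inject₁; opposite; fromℕ<)
open import Data.Fin.Properties using
  (toℕ-inject₁; toℕ-injective; toℕ-fromℕ; toℕ-fromℕ<; toℕ<n; opposite-involutive; any?)
import Data.Fin.Properties as Fin
open import Data.Nat using
  (ℕ; zero; suc; _+_; _*_; _∸_; _≤_; _<_; z≤n; s≤s; _≤?_; _<?_; _≟_; ⌊_/2⌋)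
open import Data.Nat.Divisibility using (n∣m*n)
open import Data.Nat.DivMod using (_/_; m*n/n≡m; +-distrib-/-∣ʳ)
open import Data.Nat.Properties using
  ( ≤-refl; ≤-trans; ≤-reflexive; ≤-antisym; ≤-pred; n≤1+n; m≤n⇒m≤1+n; ≤∧≢⇒<; ≮⇒≥; ≰⇒>; ≰⇒≥
  ; <⇒≱; <-cmp; n≮0; 0≢1+n; suc-injective; m≤m+n; m∸n+n≡m; n≡⌊n+n/2⌋; even≢odd
  ; *-comm; +-suc; +-comm; +-assoc; +-identityʳ; +-commutativeSemigroup; +-mono-≤; +-monoˡ-≤
  ; +-cancelˡ-≤; +-cancelʳ-≤; +-cancelˡ-≡; +-cancelʳ-≡; module ≤-Reasoning)
open import Algebra.Properties.CommutativeSemigroup +-commutativeSemigroup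
  using (x∙yz≈yx∙z; x∙yz≈y∙xz; interchange)
open import Data.Product as Product using (_×_; _,_; proj₁; proj₂; ∃-syntax; map₂)
open import Data.Product.Properties using (≡-dec)
open import Data.Sum as Sum using (_⊎_; inj₁; inj₂; [_,_]′)
open import Relation.Binary.Definitions using (tri<; tri≈; tri>; DecidableEquality)
open import Relation.Binary.PropositionalEquality using
  (_≡_; _≢_; refl; sym; trans; cong; cong₂; subst; subst₂; module ≡-Reasoning)
open import Relation.Nullary using (¬_; Dec; yes; no)
open import Relation.Nullary.Decidable using (_×-dec_; _⊎-dec_)
open import Defs

open SimpleGraph

-- Pursuit in a single diagonal coordinate.

Adjacent : ℕ → ℕ → Set
Adjacent a b = b ≡ suc a ⊎ a ≡ suc b

Near : ℕ → ℕ → Set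
Near a b = b ≤ suc a × a ≤ suc b

adjacent⇒near : ∀ {a b} → Adjacent a b → Near a b
adjacent⇒near (inj₁ refl) = ≤-refl , m≤n⇒m≤1+n (n≤1+n _)
adjacent⇒near (inj₂ refl) = m≤n⇒m≤1+n (n≤1+n _) , ≤-refl

-- A cop moves from u to u′ while the robber is on w.  If u ≡ w the step may go
-- either way: moving along one diagonal coordinate forces a move along the other.
Step : ℕ → ℕ → ℕ → Set
Step u w u′ = (u ≤ w × u′ ≡ suc u) ⊎ (w ≤ u × u ≡ suc u′)

-- Cops on u₁ and u₂, a robber on w, and k rounds left: if she is not between the
-- cops, one of them is within k of the end of [0, L] on her side.
record Lane (L k w u₁ u₂ : ℕ) : Set where
  field
    adjacent : Adjacent u₁ u₂
    below    : u₁ < w → u₂ < w → L ≤ u₁ + k ⊎ L ≤ u₂ + k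
    above    : w < u₁ → w < u₂ → u₁ ≤ k ⊎ u₂ ≤ k

open Lane

lane-swap : ∀ {L k w u₁ u₂} → Lane L k w u₁ u₂ → Lane L k w u₂ u₁
lane-swap l .adjacent = Sum.swap (l .adjacent)
lane-swap l .below p q = Sum.swap (l .below q p)
lane-swap l .above p q = Sum.swap (l .above q p)

-- A robber beyond both cops after the round was beyond them on the same side before it, as she
-- moves by at most one; both cops then advance that way, which pays for the round used up. Cops
-- stepping in opposite directions trade places and have her between them.
lane-step-up : ∀ {L k w w′ u u₁′ u₂′} → Lane L (suc k) w u (suc u) → Near w w′ →
  Step u w′ u₁′ → Step (suc u) w′ u₂′ → Lane L k w′ u₁′ u₂′
lane-step-up {L} {k} l (w′≤ , w≤) (inj₁ (p , refl)) (inj₁ (q , refl)) = record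
  { adjacent = inj₁ refl
  ; below    = λ _ r → subst (λ n → L ≤ n ⊎ L ≤ suc n) (+-suc _ k)
      (l .below (≤-trans (n≤1+n _) (≤-pred (≤-trans r w′≤))) (≤-pred (≤-trans r w′≤)))
  ; above    = λ r _ → ⊥-elim (<⇒≱ r q)
  }
lane-step-up l _ (inj₁ (p , refl)) (inj₂ (q , refl)) = record
  { adjacent = inj₂ refl
  ; below    = λ r _ → ⊥-elim (<⇒≱ r q)
  ; above    = λ _ r → ⊥-elim (<⇒≱ r p)
  }
lane-step-up l _ (inj₂ (p , _)) (inj₁ (q , _)) = ⊥-elim (<⇒≱ q p)
lane-step-up l (w′≤ , w≤) (inj₂ (p , refl)) (inj₂ (q , refl)) = record
  { adjacent = inj₁ refl
  ; below    = λ _ r → ⊥-elim (<⇒≱ r p)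
  ; above    = λ r _ → Sum.map ≤-pred ≤-pred
      (l .above (s≤s (≤-trans w≤ r)) (s≤s (≤-trans w≤ (≤-trans r (n≤1+n _)))))
  }

lane-step : ∀ {L k w w′ u₁ u₂ u₁′ u₂′} → Lane L (suc k) w u₁ u₂ → Near w w′ →
  Step u₁ w′ u₁′ → Step u₂ w′ u₂′ → Lane L k w′ u₁′ u₂′
lane-step l n s₁ s₂ with l .adjacent
... | inj₁ refl = lane-step-up l n s₁ s₂
... | inj₂ refl = lane-swap (lane-step-up (lane-swap l) n s₂ s₁)

-- With no rounds left, a robber beyond both cops would lie outside [0, L]; otherwise she is on one
-- of two consecutive numbers.
lane-locked-up : ∀ {L w u} → w ≤ L → Lane L 0 w u (suc u) → w ≡ u ⊎ w ≡ suc u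
lane-locked-up {L} {w} {u} w≤L l with <-cmp w u
... | tri≈ _ w≡u _ = inj₁ w≡u
... | tri< w<u _ _ = ⊥-elim ([ (λ p → <⇒≱ w<u (≤-trans p z≤n)) , (λ ()) ]′ (l .above w<u (m≤n⇒m≤1+n w<u)))
... | tri> _ _ u<w with suc u ≟ w
...   | yes e = inj₂ (sym e)
...   | no ne = ⊥-elim ([ absurd u<w , absurd v<w ]′ (l .below u<w v<w))
  where
  v<w = ≤∧≢⇒< u<w ne
  absurd : ∀ {v} → v < w → ¬ L ≤ v + 0
  absurd {v} v<w p = <⇒≱ v<w (≤-trans w≤L (subst (L ≤_) (+-identityʳ v) p))

lane-locked : ∀ {L w u₁ u₂} → w ≤ L → Lane L 0 w u₁ u₂ → w ≡ u₁ ⊎ w ≡ u₂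
lane-locked w≤L l with l .adjacent
... | inj₁ refl = lane-locked-up w≤L l
... | inj₂ refl = Sum.swap (lane-locked-up w≤L (lane-swap l))

-- Order arithmetic, reversal of a path, steps along a path.

ahead : ∀ {a b x y} → a + b ≤ x + y → a + y ≤ x + b → ¬ (a ≡ x × b ≡ y) → a < x
ahead {a} {b} {x} {y} p q a,b≢x,y with a <? x
... | yes a<x = a<x
-- The hypotheses say that |b - y| ≤ x - a, so x ≤ a forces b = y and then a = x.
... | no  a≮x = ⊥-elim (a,b≢x,y (≤-antisym a≤x x≤a , b≡y))
  where
  x≤a = ≮⇒≥ a≮x
  b≡y = ≤-antisym (+-cancelˡ-≤ a _ _ (≤-trans p (+-monoˡ-≤ y x≤a)))
                  (+-cancelˡ-≤ a _ _ (≤-trans q (+-monoˡ-≤ b x≤a)))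
  a≤x = +-cancelʳ-≤ y _ _ (subst (λ z → a + y ≤ x + z) b≡y q)

complement-≤ : ∀ {a x} b y {b̄ ȳ} → b + b̄ ≡ y + ȳ → a + y ≤ x + b → a + b̄ ≤ x + ȳ
complement-≤ {a} {x} b y {b̄} {ȳ} e p = +-cancelˡ-≤ y _ _ (begin
  y + (a + b̄)  ≡⟨ x∙yz≈yx∙z y a b̄ ⟩
  (a + y) + b̄  ≤⟨ +-monoˡ-≤ b̄ p ⟩
  (x + b) + b̄  ≡⟨ +-assoc x b b̄ ⟩
  x + (b + b̄)  ≡⟨ cong (x +_) e ⟩
  x + (y + ȳ)  ≡⟨ x∙yz≈y∙xz x y ȳ ⟩
  y + (x + ȳ)  ∎)
  where open ≤-Reasoning

toℕ-opposite-+ : ∀ {n} (i : Fin (suc n)) → toℕ i + toℕ (opposite i) ≡ n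
toℕ-opposite-+ {n}     zero    = toℕ-fromℕ n
toℕ-opposite-+ {suc n} (suc i) = cong suc (trans (cong (toℕ i +_) (toℕ-inject₁ (opposite i))) (toℕ-opposite-+ i))

opposite-suc : ∀ {n} {i j : Fin n} → toℕ j ≡ suc (toℕ i) → toℕ (opposite i) ≡ suc (toℕ (opposite j))
opposite-suc {suc n} {i} {j} e = +-cancelˡ-≡ (toℕ i) _ _ (begin
  toℕ i + toℕ (opposite i)         ≡⟨ toℕ-opposite-+ i ⟩
  n                                ≡⟨ toℕ-opposite-+ j ⟨
  toℕ j + toℕ (opposite j)         ≡⟨ cong (_+ toℕ (opposite j)) e ⟩
  suc (toℕ i + toℕ (opposite j))   ≡⟨ +-suc _ _ ⟨
  toℕ i + suc (toℕ (opposite j))   ∎)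
  where open ≡-Reasoning

opposite-adjacent : ∀ {n} {i j : Fin n} → Adj (Path n) i j → Adj (Path n) (opposite i) (opposite j)
opposite-adjacent (inj₁ e) = inj₂ (opposite-suc e)
opposite-adjacent (inj₂ e) = inj₁ (opposite-suc e)

toward : ∀ {n} → Fin n → Fin n → Fin n
toward {suc zero}    zero    zero    = zero
toward {suc (suc n)} zero    zero    = zero
toward {suc (suc n)} zero    (suc _) = suc zero
toward {suc (suc n)} (suc i) zero    = inject₁ i
toward {suc (suc n)} (suc i) (suc j) = suc (toward i j)

toward-up : ∀ {n} (i j : Fin n) → toℕ i < toℕ j → toℕ (toward i j) ≡ suc (toℕ i)
toward-up {suc (suc n)} zero    (suc j) _       = refl
toward-up {suc (suc n)} (suc i) (suc j) (s≤s p) = cong suc (toward-up i j p)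

toward-down : ∀ {n} (i j : Fin n) → toℕ j < toℕ i → toℕ i ≡ suc (toℕ (toward i j))
toward-down {suc (suc n)} (suc i) zero    _       = cong suc (sym (toℕ-inject₁ i))
toward-down {suc (suc n)} (suc i) (suc j) (s≤s p) = cong suc (toward-down i j p)

toward-move : ∀ {n} (i j : Fin n) → i ≡ toward i j ⊎ Adj (Path n) i (toward i j)
toward-move i j with <-cmp (toℕ i) (toℕ j)
... | tri< i<j _ _ = inj₂ (inj₁ (toward-up i j i<j))
... | tri> _ _ j<i = inj₂ (inj₂ (toward-down i j j<i))
... | tri≈ _ i≡j _ = inj₁ (trans (sym (toward-self i)) (cong (toward i) (toℕ-injective i≡j)))
  where
  toward-self : ∀ {n} (i : Fin n) → toward i i ≡ i
  toward-self {suc zero}    zero    = refl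
  toward-self {suc (suc n)} zero    = refl
  toward-self {suc (suc n)} (suc i) = cong suc (toward-self i)

-- Robber strategies that follow a target vertex.

module Game (G : SimpleGraph) (k : ℕ) (_≟ᵥ_ : DecidableEquality (Vertex G)) (adj? : ∀ p q → Dec (Adj G p q)) where

  open CopsAndRobber G k

  move? : ∀ p q → Dec (Move p q)
  move? p q = (p ≟ᵥ q) ⊎-dec adj? p q

  caught? : ∀ c r → Dec (Caught c r)
  caught? c r = any? (λ i → c i ≟ᵥ r)

  AllMove : Cops → Cops → Set
  AllMove c c′ = ∀ i → Move (c i) (c′ i)

  -- Staying is the default because legality is demanded on every history, also on those where the
  -- target is out of reach.
  cautious : Cops → Vertex G → Vertex G → Vertex G
  cautious c target r with caught? c target | move? r target
  ... | no _ | yes _ = target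
  ... | _    | _     = r

  cautious-move : ∀ c target r → Move r (cautious c target r)
  cautious-move c target r with caught? c target | move? r target
  ... | no _  | yes m = m
  ... | no _  | no _  = inj₁ refl
  ... | yes _ | _     = inj₁ refl

  cautious-safe : ∀ c target r → ¬ Caught c r → ¬ Caught c (cautious c target r)
  cautious-safe c target r safe with caught? c target | move? r target
  ... | no s  | yes _ = s
  ... | no _  | no _  = safe
  ... | yes _ | _     = safe

  cautious-reaches : ∀ c target r → ¬ Caught c target → Move r target → cautious c target r ≡ target
  cautious-reaches c target r s m with caught? c target | move? r target
  ... | no _  | yes _ = refl
  ... | no _  | no ¬m = ⊥-elim (¬m m)
  ... | yes t | _     = ⊥-elim (s t)

  placement : (Cops → Vertex G) → Vertex G → Cops → Vertex G
  placement f z c with caught? c (f c)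
  ... | yes _ = z
  ... | no _  = f c

  placement-safe : ∀ f z c → (Caught c (f c) → ¬ Caught c z) → ¬ Caught c (placement f z c)
  placement-safe f z c p with caught? c (f c)
  ... | yes t = p t
  ... | no s  = s

  placement-free : ∀ f z c → ¬ Caught c (f c) → placement f z c ≡ f c
  placement-free f z c s with caught? c (f c)
  ... | yes t = ⊥-elim (s t)
  ... | no _  = refl

  following : (Cops → Vertex G) → Vertex G → RobberStrategy
  following f z = record
    { start = placement f z
    ; next  = λ h c → cautious c (f c) (robber h)
    ; legal = λ h c → cautious-move c (f c) (robber h)
    }

  -- Q r c is meant to say that following f survives r further moves of the cops on c.
  -- At r = 0 the vertex f c itself may be occupied: the robber then stays put or,
  -- in round 0, starts on z instead.
  module Evasion (f : Cops → Vertex G) (z : Vertex G) (Q : ℕ → Cops → Set)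
    (last   : ∀ {c} → Q 0 c → Caught c (f c) → ¬ Caught c z)
    (evades : ∀ {r c c′} → Q (suc r) c → AllMove c c′ →
              ¬ Caught c′ (f c) × Move (f c) (f c′) × Q r c′)
    (σ : CopStrategy) where

    private
      ρ = following f z
      h : ℕ → History
      h = play σ ρ
      Q₀ : ℕ → Set
      Q₀ n = Q n (CopStrategy.start σ)

    safe : ∀ {r c} → Q (suc r) c → ¬ Caught c (f c)
    -- Standing still is one of the cop moves that `evades` answers.
    safe q = proj₁ (evades q (λ _ → inj₁ refl))

    record Good (r t : ℕ) : Set where
      field
        survives : Q r (cops (h t))
        onTarget : ∀ {r′} → r ≡ suc r′ → robber (h t) ≡ f (cops (h t))
        free     : ¬ Caught (cops (h t)) (robber (h t))

    open Good

    good-start : ∀ r → Q r (CopStrategy.start σ) → Good r 0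
    good-start r q .survives = q
    good-start (suc r) q .onTarget refl = placement-free f z _ (safe q)
    good-start zero q .free = placement-safe f z _ (last q)
    good-start (suc r) q .free = placement-safe f z _ (λ t → ⊥-elim (safe q t))

    good-step : ∀ r t → Good (suc r) t →
      ¬ Caught (cops (h (suc t))) (robber (h t)) × Good r (suc t)
    good-step r t g = missed , record
      { survives = proj₂ (proj₂ e)
      ; onTarget = λ { refl → cautious-reaches _ _ _ (safe (proj₂ (proj₂ e)))
          (subst (λ v → Move v (f (cops (h (suc t))))) (sym (g .onTarget refl)) (proj₁ (proj₂ e))) }
      ; free = cautious-safe _ _ _ missed
      }
      where
      e = evades (g .survives) (CopStrategy.legal σ (h t))
      missed : ¬ Caught (cops (h (suc t))) (robber (h t))
      missed = subst (λ v → ¬ Caught (cops (h (suc t))) v) (sym (g .onTarget refl)) (proj₁ e)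

    -- Induction on the rounds played: each one turns a unit of the initial budget `r + t` from
    -- remaining into played.
    good : ∀ r t → Q₀ (r + t) → Good r t
    good r zero q = good-start r (subst Q₀ (+-identityʳ r) q)
    good r (suc t) q = proj₂ (good-step r t (good (suc r) t (subst Q₀ (+-suc r t) q)))

    uncaptured : ∀ r t → Q₀ (r + t) → ¬ CapturedInRound σ ρ t
    uncaptured r zero    q c = good r zero q .free c
    uncaptured r (suc t) q c with good-step r t (good (suc r) t (subst Q₀ (+-suc r t) q))
    ... | missed , g = [ missed , g .free ]′ c

    escapes : ∀ s t → t ≤ s → Q₀ s → ¬ CapturedInRound σ ρ t
    escapes s t t≤s q = uncaptured (s ∸ t) t (subst Q₀ (sym (m∸n+n≡m t≤s)) q)

-- Diagonal coordinates of the grid and the greedy step.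

double-injective : ∀ {a x} → a + a ≡ x + x → a ≡ x
double-injective {a} {x} e = trans (n≡⌊n+n/2⌋ a) (trans (cong ⌊_/2⌋ e) (sym (n≡⌊n+n/2⌋ x)))

double≢suc-double : ∀ a x → a + a ≢ suc (x + x)
double≢suc-double a x e = even≢odd a x (trans (double a) (trans e (cong suc (sym (double x)))))
  where
  double : ∀ n → 2 * n ≡ n + n
  double n = cong (n +_) (+-identityʳ n)

module Grid (M N : ℕ) where

  G : SimpleGraph
  G = Path (suc M) □ Path (suc N)

  V : Set
  V = Vertex G

  _≟ᵥ_ : DecidableEquality V
  _≟ᵥ_ = ≡-dec Fin._≟_ Fin._≟_

  path-adj? : ∀ {n} (i j : Fin n) → Dec (Adj (Path n) i j)
  path-adj? i j = (toℕ j ≟ suc (toℕ i)) ⊎-dec (toℕ i ≟ suc (toℕ j))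

  adj? : ∀ p q → Dec (Adj G p q)
  adj? (a , b) (x , y) = ((a Fin.≟ x) ×-dec path-adj? b y) ⊎-dec ((b Fin.≟ y) ×-dec path-adj? a x)

  open Game G 2 _≟ᵥ_ adj? public
  open CopsAndRobber G 2 public

  PathMove : ∀ {n} → Fin n → Fin n → Set
  PathMove {n} i j = i ≡ j ⊎ Adj (Path n) i j

  vertical : ∀ {a b y} → PathMove b y → Move (a , b) (a , y)
  vertical (inj₁ refl) = inj₁ refl
  vertical (inj₂ e)    = inj₂ (inj₁ (refl , e))

  horizontal : ∀ {a b x} → PathMove a x → Move (a , b) (x , b)
  horizontal (inj₁ refl) = inj₁ refl
  horizontal (inj₂ e)    = inj₂ (inj₂ (refl , e))

  -- Edges may collapse to stays: the reflections keep edges, but `antipode` does not.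
  move-map : {f : Fin (suc M) → Fin (suc M)} {g : Fin (suc N) → Fin (suc N)} →
    (∀ {i j} → Adj (Path (suc M)) i j → PathMove (f i) (f j)) →
    (∀ {i j} → Adj (Path (suc N)) i j → PathMove (g i) (g j)) →
    ∀ {p q} → Move p q → Move (Product.map f g p) (Product.map f g q)
  move-map F H (inj₁ refl)              = inj₁ refl
  move-map F H (inj₂ (inj₁ (refl , e))) = vertical (H e)
  move-map F H (inj₂ (inj₂ (refl , e))) = horizontal (F e)

  mirror : V → V
  mirror = map₂ opposite

  rotate : V → V
  rotate (a , b) = opposite a , opposite b

  mirror-move : ∀ {p q} → Move p q → Move (mirror p) (mirror q)
  mirror-move = move-map inj₂ (λ {i} {j} e → inj₂ (opposite-adjacent {i = i} {j} e))

  rotate-move : ∀ {p q} → Move p q → Move (rotate p) (rotate q)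
  rotate-move = move-map (λ {i} {j} e → inj₂ (opposite-adjacent {i = i} {j} e))
                         (λ {i} {j} e → inj₂ (opposite-adjacent {i = i} {j} e))

  -- Obtaining `v` by reflection makes every fact about `u` available for `v`.
  u v : V → ℕ
  u (a , b) = toℕ a + toℕ b
  v p = u (mirror p)

  u-near : ∀ {p q} → Move p q → Near (u p) (u q)
  u-near (inj₁ refl) = n≤1+n _ , n≤1+n _
  u-near {a , b} {_ , y} (inj₂ (inj₁ (refl , e))) = adjacent⇒near (Sum.map (up a) (up a) e)
    where
    up : ∀ {n n₁ n₂} (a : Fin n) → n₂ ≡ suc n₁ → toℕ a + n₂ ≡ suc (toℕ a + n₁)
    up a e = trans (cong (toℕ a +_) e) (+-suc _ _)
  u-near {a , b} (inj₂ (inj₂ (refl , e))) = adjacent⇒near (Sum.map (cong (_+ toℕ b)) (cong (_+ toℕ b)) e)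

  u≤ : ∀ p → u p ≤ M + N
  u≤ (a , b) = +-mono-≤ (≤-pred (toℕ<n a)) (≤-pred (toℕ<n b))

  -- For p = (a, b) the sum is 2a + N: so `u` and `v` determine the vertex, and the parity of their
  -- sum is the same on the whole grid.
  u+v : ∀ p → u p + v p ≡ (toℕ (proj₁ p) + toℕ (proj₁ p)) + N
  u+v (a , b) = trans (interchange (toℕ a) (toℕ b) (toℕ a) _) (cong (toℕ a + toℕ a +_) (toℕ-opposite-+ b))

  u-v-injective : ∀ {p q} → u p ≡ u q → v p ≡ v q → p ≡ q
  u-v-injective {a , b} {x , y} e e′ = cong₂ _,_ (toℕ-injective a≡x)
      (toℕ-injective (+-cancelˡ-≡ (toℕ a) _ _ (trans e (cong (_+ toℕ y) (sym a≡x)))))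
    where
    a≡x : toℕ a ≡ toℕ x
    a≡x = double-injective (+-cancelʳ-≡ N _ _ (trans (sym (u+v (a , b))) (trans (cong₂ _+_ e e′) (u+v (x , y)))))

  u+v-parity : ∀ p q → u q + v q ≢ suc (u p + v p)
  u+v-parity p q e = double≢suc-double (toℕ (proj₁ q)) (toℕ (proj₁ p))
    (+-cancelʳ-≡ N _ _ (trans (sym (u+v q)) (trans e (cong suc (u+v p)))))

  -- The values of u + v at r and q would differ by exactly one, against parity.
  mixed-lock : ∀ {r p q} → u r ≡ u p → v r ≡ v q → ¬ Adjacent (u p) (u q)
  mixed-lock {r} {p} {q} e e′ (inj₁ f) = u+v-parity r q (trans (cong₂ _+_ (trans f (cong suc (sym e))) (sym e′)) refl)
  mixed-lock {r} {p} {q} e e′ (inj₂ f) = u+v-parity q r (cong₂ _+_ (trans e f) e′)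

  -- The first test is u c ≤ u r, the second is v c ≤ v r cleared of complements.
  greedy : V → V → V
  greedy (a , b) (x , y) with toℕ a + toℕ b ≤? toℕ x + toℕ y | toℕ a + toℕ y ≤? toℕ x + toℕ b
  ... | yes _ | yes _ = toward a x , b
  ... | no _  | no _  = toward a x , b
  ... | yes _ | no _  = a , toward b y
  ... | no _  | yes _ = a , toward b y

  greedy-move : ∀ c r → Move c (greedy c r)
  greedy-move (a , b) (x , y) with toℕ a + toℕ b ≤? toℕ x + toℕ y | toℕ a + toℕ y ≤? toℕ x + toℕ b
  ... | yes _ | yes _ = horizontal (toward-move a x)
  ... | no _  | no _  = horizontal (toward-move a x)
  ... | yes _ | no _  = vertical (toward-move b y)
  ... | no _  | yes _ = vertical (toward-move b y)

  -- Equal signs in u and v call for a step in the first coordinate, different signs for one in the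
  -- second; `ahead` shows that the cop still has a distance to cover there, so `toward` really
  -- moves him.
  greedy-step : ∀ c r → c ≢ r → Step (u c) (u r) (u (greedy c r)) × Step (v c) (v r) (v (greedy c r))
  greedy-step (a , b) (x , y) c≢r with toℕ a + toℕ b ≤? toℕ x + toℕ y | toℕ a + toℕ y ≤? toℕ x + toℕ b
  ... | yes p | yes q = inj₁ (p , cong (_+ toℕ b) e) ,
      inj₁ (complement-≤ (toℕ b) (toℕ y) co q , cong (_+ _) e)
    where
    co = trans (toℕ-opposite-+ b) (sym (toℕ-opposite-+ y))
    e = toward-up a x (ahead p q λ (e , e′) → c≢r (cong₂ _,_ (toℕ-injective e) (toℕ-injective e′)))
  ... | no p | no q = inj₂ (≰⇒≥ p , cong (_+ toℕ b) e) ,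
      inj₂ (complement-≤ (toℕ y) (toℕ b) co (≰⇒≥ q) , cong (_+ _) e)
    where
    co = trans (toℕ-opposite-+ y) (sym (toℕ-opposite-+ b))
    e = toward-down a x (ahead (≰⇒≥ p) (≰⇒≥ q) λ (e , e′) → c≢r (sym (cong₂ _,_ (toℕ-injective e) (toℕ-injective e′))))
  ... | yes p | no q = inj₁ (p , trans (cong (toℕ a +_) e) (+-suc _ _)) ,
      inj₂ (complement-≤ (toℕ y) (toℕ b) co (≰⇒≥ q) ,
            trans (cong (toℕ a +_) (opposite-suc {i = b} {toward b y} e)) (+-suc _ _))
    where
    co = trans (toℕ-opposite-+ y) (sym (toℕ-opposite-+ b))
    e = toward-up b y (ahead
          (subst₂ _≤_ (+-comm (toℕ a) _) (+-comm (toℕ x) _) p)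
          (subst₂ _≤_ (+-comm (toℕ x) _) (+-comm (toℕ a) _) (≰⇒≥ q))
          λ (e , e′) → c≢r (cong₂ _,_ (toℕ-injective e′) (toℕ-injective e)))
  ... | no p | yes q = inj₂ (≰⇒≥ p , trans (cong (toℕ a +_) e) (+-suc _ _)) ,
      inj₁ (complement-≤ (toℕ b) (toℕ y) co q ,
            trans (cong (toℕ a +_) (opposite-suc {i = toward b y} {b} e)) (+-suc _ _))
    where
    co = trans (toℕ-opposite-+ b) (sym (toℕ-opposite-+ y))
    e = toward-down b y (ahead
          (subst₂ _≤_ (+-comm (toℕ x) _) (+-comm (toℕ a) _) (≰⇒≥ p))
          (subst₂ _≤_ (+-comm (toℕ a) _) (+-comm (toℕ x) _) q)
          λ (e , e′) → c≢r (sym (cong₂ _,_ (toℕ-injective e′) (toℕ-injective e))))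

  -- The cops' chase in both coordinates.

  Lanes : ℕ → Cops → Robber → Set
  Lanes k c r = Lane (M + N) k (u r) (u (c zero)) (u (c (suc zero))) ×
                Lane (M + N) k (v r) (v (c zero)) (v (c (suc zero)))

  lanes-step : ∀ {k c r r′} → Lanes (suc k) c r → Move r r′ → ¬ Caught c r′ → Lanes k (λ i → greedy (c i) r′) r′
  lanes-step {k} {c} {r} {r′} (l , l′) m free =
    lane-step l (u-near m) (proj₁ (s zero)) (proj₁ (s (suc zero))) ,
    lane-step l′ (u-near (mirror-move m)) (proj₂ (s zero)) (proj₂ (s (suc zero)))
    where
    s = λ i → greedy-step (c i) r′ (λ e → free (i , e))

  lanes-caught : ∀ {c r} → Lanes 0 c r → Caught c r
  lanes-caught {c} {r} (l , l′) with lane-locked (u≤ r) l | lane-locked (u≤ (mirror r)) l′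
  ... | inj₁ e | inj₁ e′ = zero , sym (u-v-injective e e′)
  ... | inj₂ e | inj₂ e′ = suc zero , sym (u-v-injective e e′)
  ... | inj₁ e | inj₂ e′ = ⊥-elim (mixed-lock {r} {c zero} {c (suc zero)} e e′ (l .adjacent))
  ... | inj₂ e | inj₁ e′ = ⊥-elim (mixed-lock {r} {c (suc zero)} {c zero} e e′ (Sum.swap (l .adjacent)))

  chase : Cops → CopStrategy
  chase c = record
    { start = c
    ; next  = λ h i → greedy (cops h i) (robber h)
    ; legal = λ h i → greedy-move (cops h i) (robber h)
    }

  module Chase (T : ℕ) (c : Cops) (good : ∀ r → Lanes (suc T) c r) (ρ : RobberStrategy) where

    private
      h : ℕ → History
      h = play (chase c) ρ

    -- The robber's position that the cops' moves in round t respond to.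
    previous : ℕ → Robber
    previous zero    = robber (h zero)
    previous (suc t) = robber (h t)

    previous-move : ∀ t → Move (previous t) (robber (h t))
    previous-move zero    = inj₁ refl
    previous-move (suc t) = RobberStrategy.legal ρ (h t) _

    captured : ∀ t → Caught (cops (h t)) (robber (h t)) → CapturedInRound (chase c) ρ t
    captured zero    e = e
    captured (suc t) e = inj₂ e

    -- A round can be charged to the lanes only while she is free, since `greedy-step` needs cop and
    -- robber apart; if she is not free, the game is already over.
    chased : ∀ k t → k + t ≡ suc T →
      (∃[ s ] s ≤ t × CapturedInRound (chase c) ρ s) ⊎ Lanes k (cops (h t)) (previous t)
    chased k zero e = inj₂ (subst (λ k → Lanes k c (robber (h zero))) (trans (sym e) (+-identityʳ k))
      (good (robber (h zero))))
    chased k (suc t) e with chased (suc k) t (trans (sym (+-suc k t)) e)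
    ... | inj₁ (s , s≤t , cap) = inj₁ (s , m≤n⇒m≤1+n s≤t , cap)
    ... | inj₂ l with caught? (cops (h t)) (robber (h t))
    ...   | yes cap = inj₁ (t , n≤1+n t , captured t cap)
    ...   | no free = inj₂ (lanes-step l (previous-move t) free)

    capture : ∃[ s ] s ≤ suc T × CapturedInRound (chase c) ρ s
    capture with chased 0 (suc T) refl
    ... | inj₁ cap = cap
    -- The lanes concern her position before her own move of this round, so it is the cops' move
    -- that catches her.
    ... | inj₂ l   = suc T , ≤-refl , inj₁ (lanes-caught l)

-- Central starting vertices for the cops.

Spread : ℕ → ℕ → ℕ → ℕ → Set
Spread L T u₁ u₂ = Adjacent u₁ u₂ × (L ≤ u₁ + T ⊎ L ≤ u₂ + T) × (u₁ ≤ T ⊎ u₂ ≤ T)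

-- The bounds hold whichever side she is on, so one placement serves against all her starting
-- vertices.
spread⇒lane : ∀ {L T u₁ u₂} → Spread L T u₁ u₂ → ∀ w → Lane L T w u₁ u₂
spread⇒lane (adj , lo , hi) w = record { adjacent = adj ; below = λ _ _ → lo ; above = λ _ _ → hi }

spread-swap : ∀ {L T u₁ u₂} → Spread L T u₁ u₂ → Spread L T u₂ u₁
spread-swap (adj , lo , hi) = Sum.swap adj , Sum.swap lo , Sum.swap hi

spread-even : ∀ T {w} → Adjacent T w → Spread (T + T) T T w
spread-even T adj = adj , inj₁ ≤-refl , inj₁ ≤-refl

spread-odd : ∀ T → Spread (suc (T + T)) T T (suc T)
spread-odd T = inj₁ refl , inj₂ ≤-refl , inj₁ ≤-refl

Central : ℕ → ℕ → ℕ → Set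
Central M N T = ∃[ p ] ∃[ q ] Spread (M + N) T (u p) (u q) × Spread (M + N) T (v p) (v q)
  where open Grid M N

data Half : ℕ → Set where
  even : ∀ h → Half (h + h)
  odd  : ∀ h → Half (suc (h + h))

half : ∀ n → Half n
half zero    = even zero
half (suc n) with half n
... | even h = odd h
... | odd h  = subst (λ n → Half (suc n)) (+-suc h h) (even (suc h))

module _ {M N : ℕ} where

  open Grid M N

  at : ∀ i i′ j j′ → i + i′ ≡ M → j + j′ ≡ N → ∃[ p ] u p ≡ i + j × v p ≡ i + j′
  at i i′ j j′ e f = (fromℕ< i<M , fromℕ< j<N) , cong₂ _+_ x y , cong₂ _+_ x
      (+-cancelˡ-≡ j _ _ (trans (cong (_+ toℕ (opposite (fromℕ< j<N))) (sym y))
        (trans (toℕ-opposite-+ (fromℕ< j<N)) (sym f))))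
    where
    i<M = s≤s (subst (i ≤_) e (m≤m+n i i′))
    j<N = s≤s (subst (j ≤_) f (m≤m+n j j′))
    x = toℕ-fromℕ< i<M
    y = toℕ-fromℕ< j<N

  central-at : ∀ {L T u₁ u₂ v₁ v₂} → M + N ≡ L → ∃[ p ] u p ≡ u₁ × v p ≡ v₁ → ∃[ q ] u q ≡ u₂ × v q ≡ v₂ →
    Spread L T u₁ u₂ → Spread L T v₁ v₂ → Central M N T
  central-at refl (p , refl , refl) (q , refl , refl) s s′ = p , q , s , s′

-- If M or N is odd, the path in that direction has two middle vertices and the cops take one each
-- (in the first direction if both are odd). If both are even, one cop takes the centre and the
-- other a neighbour in the second direction, which exists by `1≤N`.
central : ∀ {M N} → 1 ≤ N → Half M → Half N →
  ∃[ T ] (M + N ≡ T + T ⊎ M + N ≡ suc (T + T)) × Central M N T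
central 1≤N (odd h) (even k) = h + k , inj₂ e ,
  central-at e (at h (suc h) k k (+-suc h h) refl) (at (suc h) h k k refl refl)
    (spread-odd (h + k)) (spread-odd (h + k))
  where e = cong suc (interchange h h k k)
central 1≤N (odd h) (odd k) = suc (h + k) , inj₁ e ,
  central-at e (at h (suc h) k (suc k) (+-suc h h) (+-suc k k)) (at (suc h) h k (suc k) refl (+-suc k k))
    (spread-swap (spread-even (suc (h + k)) (inj₂ refl)))
    (subst (λ n → Spread (suc (h + k) + suc (h + k)) (suc (h + k)) n (suc n)) (sym (+-suc h k))
      (spread-even (suc (h + k)) (inj₁ refl)))
  where
  e = cong suc (trans (+-suc (h + h) (k + k))
    (trans (cong suc (interchange h h k k)) (sym (+-suc (h + k) (h + k)))))
central 1≤N (even h) (odd k) = h + k , inj₂ e ,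
  central-at e (at h h k (suc k) refl (+-suc k k)) (at h h (suc k) k refl refl)
    (subst (Spread (suc (h + k + (h + k))) (h + k) (h + k)) (sym (+-suc h k)) (spread-odd (h + k)))
    (subst (λ n → Spread (suc (h + k + (h + k))) (h + k) n (h + k)) (sym (+-suc h k))
      (spread-swap (spread-odd (h + k))))
  where e = trans (+-suc (h + h) (k + k)) (cong suc (interchange h h k k))
central () (even h) (even zero)
central 1≤N (even h) (even (suc k)) = h + suc k , inj₁ e ,
  central-at e (at h h (suc k) (suc k) refl refl) (at h h (suc (suc k)) k refl (cong suc (sym (+-suc k k))))
    (spread-even (h + suc k) (inj₁ (+-suc h (suc k)))) (spread-even (h + suc k) (inj₂ (+-suc h k)))
  where e = interchange h h (suc k) (suc k)

central⇒cops-win : ∀ {M N T} → Central M N (suc T) → Grid.CopsWinWithin M N (suc T)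
central⇒cops-win {M} {N} {T} (p , q , s , s′) = Grid.chase M N c ,
  Grid.Chase.capture M N T c (λ r → spread⇒lane s _ , spread⇒lane s′ _)
  where
  c : Grid.Cops M N
  c zero       = p
  c (suc zero) = q

-- Evasion at two opposite corners.

swap₂ : ∀ {n} → Fin (suc (suc n)) → Fin (suc (suc n))
swap₂ zero    = suc zero
swap₂ (suc _) = zero

swap₂-≢ : ∀ {n} (i : Fin (suc (suc n))) → i ≢ swap₂ i
swap₂-≢ zero    ()
swap₂-≢ (suc _) ()

module Evader (M N : ℕ) where

  open Grid (suc M) (suc N)

  origin : V
  origin = zero , zero

  -- The retraction of the grid onto the 4-cycle at the origin, followed by the antipodal map of
  -- that cycle.
  antipode : V → V
  antipode = Product.map swap₂ swap₂

  swap₂-move : ∀ {n} {i j : Fin (suc (suc n))} → Adj (Path (suc (suc n))) i j → PathMove (swap₂ i) (swap₂ j)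
  swap₂-move {i = zero}  {zero}  _ = inj₁ refl
  swap₂-move {i = zero}  {suc _} _ = inj₂ (inj₂ refl)
  swap₂-move {i = suc _} {zero}  _ = inj₂ (inj₁ refl)
  swap₂-move {i = suc _} {suc _} _ = inj₁ refl

  antipode-move : ∀ {p q} → Move p q → Move (antipode p) (antipode q)
  antipode-move = move-map (λ {i} {j} → swap₂-move {i = i} {j}) (λ {i} {j} → swap₂-move {i = i} {j})

  -- A move keeps at least one coordinate, and `swap₂` has no fixed point.
  antipode-unreachable : ∀ p → ¬ Move p (antipode p)
  antipode-unreachable (a , b) (inj₁ e)              = swap₂-≢ a (cong proj₁ e)
  antipode-unreachable (a , b) (inj₂ (inj₁ (e , _))) = swap₂-≢ a e
  antipode-unreachable (a , b) (inj₂ (inj₂ (e , _))) = swap₂-≢ b e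

  antipode≤2 : ∀ p → u (antipode p) ≤ 2
  antipode≤2 (zero  , zero)  = ≤-refl
  antipode≤2 (zero  , suc _) = n≤1+n 1
  antipode≤2 (suc _ , zero)  = n≤1+n 1
  antipode≤2 (suc _ , suc _) = z≤n

  2≤antipode⇒origin : ∀ p → 2 ≤ u (antipode p) → u p ≡ 0
  2≤antipode⇒origin (zero  , zero)  _        = refl
  2≤antipode⇒origin (zero  , suc _) (s≤s ())
  2≤antipode⇒origin (suc _ , zero)  (s≤s ())
  2≤antipode⇒origin (suc _ , suc _) ()

  Escape : ℕ → CopStrategy → Set
  Escape s σ = ∃[ ρ ] ∀ t → t ≤ s → ¬ CapturedInRound σ ρ t

  -- Play at the corner `φ origin` is play at the origin seen through φ, and `d` is the distance to
  -- that corner.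
  module Corner (φ : V → V) (φ-involutive : ∀ p → φ (φ p) ≡ p)
    (φ-move : ∀ {p q} → Move p q → Move (φ p) (φ q)) where

    d : V → ℕ
    d p = u (φ p)

    d-near : ∀ {p q} → Move p q → d p ≤ suc (d q)
    d-near m = proj₂ (u-near (φ-move m))

    d-φ : ∀ {p q} → p ≡ φ q → d p ≡ u q
    d-φ refl = cong u (φ-involutive _)

    wait : ∀ s σ → (∀ i → s < d (CopStrategy.start σ i)) → Escape s σ
    wait s σ far = following (λ _ → φ origin) (φ origin) , λ t t≤s →
      Evasion.escapes (λ _ → φ origin) (φ origin) (λ r c → ∀ i → r < d (c i))
        (λ {c} q (i , e) → ⊥-elim (<⇒≱ (q i) (≤-reflexive (d-φ e))))
        (λ {r} {c} {c′} q m →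
          (λ (i , e) → absurd (subst (λ n → suc r < suc n) (d-φ e) (≤-trans (q i) (d-near (m i))))) ,
          inj₁ refl ,
          λ i → ≤-pred (≤-trans (q i) (d-near (m i))))
        σ s t t≤s far
      where
      absurd : ∀ {r} → ¬ suc r < 1
      absurd (s≤s ())

    module Circle (i j : Fin 2) (cover : ∀ x → x ≡ i ⊎ x ≡ j) where

      -- Cop j reaches distance 2 only with the last of r moves; he then threatens the
      -- robber only if cop i, standing in the corner, has driven her to that distance.
      Remote : ℕ → Cops → Set
      Remote r c = 2 + r ≤ d (c j) × (r ≤ d (c i) ⊎ 3 + r ≤ d (c j))

      target : Cops → V
      target c = φ (antipode (φ (c i)))

      refuge : V
      refuge = φ (zero , suc zero)

      unreachable : ∀ {p q} → Move p q → q ≢ φ (antipode (φ p))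
      unreachable {p} m e = antipode-unreachable (φ p)
        (subst (Move (φ p)) (trans (cong φ e) (φ-involutive _)) (φ-move m))

      at-origin : ∀ {c p} → 2 ≤ d p → p ≡ target c → d (c i) ≡ 0
      at-origin {c} 2≤d e = 2≤antipode⇒origin (φ (c i)) (subst (2 ≤_) (d-φ e) 2≤d)

      -- Only cop j can be on the target; being at distance at least 2, he is on the far vertex of
      -- the cycle, so cop i is in the corner. Neither is then at distance 1, where `refuge` lies.
      last : ∀ {c} → Remote 0 c → Caught c (target c) → ¬ Caught c refuge
      last {c} (far , _) (x , e) (y , e′) with cover x | cover y
      ... | inj₁ refl | _         = unreachable (inj₁ refl) e
      ... | inj₂ refl | inj₁ refl = 0≢1+n (trans (sym (at-origin {c} far e)) (d-φ e′))
      ... | inj₂ refl | inj₂ refl = <⇒≱ far (≤-reflexive (d-φ e′))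

      missed : ∀ {r c c′} → Remote (suc r) c → AllMove c c′ → ¬ Caught c′ (target c)
      missed {r} {c} {c′} (far , room) m (x , e) with cover x
      ... | inj₁ refl = unreachable (m i) e
      ... | inj₂ refl = [ (λ p → n≮0 (subst (suc r ≤_) (at-origin {c} 2≤d e) p)) , absurd ]′ room
        where
        near : 3 + r ≤ suc (d (c′ j))
        near = ≤-trans far (d-near (m j))
        2≤d : 2 ≤ d (c′ j)
        2≤d = ≤-trans (m≤m+n 2 r) (≤-pred near)
        absurd : ¬ 4 + r ≤ d (c j)
        absurd p = <⇒≱ (≤-trans (m≤m+n 3 r) (≤-pred (≤-trans p (d-near (m j)))))
          (subst (_≤ 2) (sym (d-φ e)) (antipode≤2 (φ (c i))))

      evades : ∀ {r c c′} → Remote (suc r) c → AllMove c c′ →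
        ¬ Caught c′ (target c) × Move (target c) (target c′) × Remote r c′
      evades {c = c} {c′} q@(far , room) m = missed {c = c} {c′} q m , φ-move (antipode-move (φ-move (m i))) ,
        ≤-pred (≤-trans far (d-near (m j))) ,
        Sum.map (λ p → ≤-pred (≤-trans p (d-near (m i)))) (λ p → ≤-pred (≤-trans p (d-near (m j)))) room

      circle : ∀ s σ → Remote s (CopStrategy.start σ) → Escape s σ
      circle s σ q = following target refuge ,
        λ t t≤s → Evasion.escapes target refuge Remote (λ {c} → last {c})
          (λ {r} {c} {c′} → evades {r} {c} {c′}) σ s t t≤s q

  module SW = Corner (λ p → p) (λ _ → refl) (λ m → m)
  module NE = Corner rotate (λ (a , b) → cong₂ _,_ (opposite-involutive a) (opposite-involutive b)) rotate-move

  opposite-corners : ∀ p → SW.d p + NE.d p ≡ suc M + suc N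
  opposite-corners (a , b) = trans (interchange (toℕ a) (toℕ b) _ _) (cong₂ _+_ (toℕ-opposite-+ a) (toℕ-opposite-+ b))

  remainder : ∀ {l g} p → l + g ≤ suc M + suc N → SW.d p ≤ l → g ≤ NE.d p
  remainder {l} {g} p l+g≤ d≤l = +-cancelˡ-≤ l _ _ (begin
    l + g             ≤⟨ l+g≤ ⟩
    suc M + suc N     ≡⟨ opposite-corners p ⟨
    SW.d p + NE.d p   ≤⟨ +-monoˡ-≤ _ d≤l ⟩
    l + NE.d p        ∎)
    where open ≤-Reasoning

  module _ (s : ℕ) (small : s + (2 + s) ≤ suc M + suc N) (σ : CopStrategy) where

    private
      c = CopStrategy.start σ

    -- A cop's distances to the two corners add up to at least 2s + 2, so cop i is at least s + 2
    -- from NE. If cop j is more than s from NE, she waits there. If he is at least s + 3 from SW,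
    -- she circles there against cop i. Otherwise he is at least s from NE, and she circles at NE
    -- against him, with cop i as the remote one.
    split : (i j : Fin 2) → (∀ x → x ≡ i ⊎ x ≡ j) → SW.d (c i) ≤ s → s < SW.d (c j) → Escape s σ
    split i j cover near far with suc s ≤? NE.d (c j) | 3 + s ≤? SW.d (c j)
    ... | yes p | _     = NE.wait s σ λ x →
      [ (λ { refl → ≤-trans (n≤1+n _) (remainder (c i) small near) }) , (λ { refl → p }) ]′ (cover x)
    ... | no _  | yes q = SW.Circle.circle i j cover s σ (≤-trans (n≤1+n _) q , inj₂ q)
    ... | no _  | no q  = NE.Circle.circle j i (λ x → Sum.swap (cover x)) s σ
      (remainder (c i) small near , inj₁ (remainder (c j)
        (subst (_≤ suc M + suc N) (+-comm s (2 + s)) small) (≤-pred (≰⇒> q))))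

    escape : Escape s σ
    escape with suc s ≤? SW.d (c zero) | suc s ≤? SW.d (c (suc zero))
    ... | yes p | yes q = SW.wait s σ λ { zero → p ; (suc zero) → q }
    ... | no p  | no q  = NE.wait s σ λ
      { zero       → ≤-trans (n≤1+n _) (remainder (c zero) small (≤-pred (≰⇒> p)))
      ; (suc zero) → ≤-trans (n≤1+n _) (remainder (c (suc zero)) small (≤-pred (≰⇒> q))) }
    ... | no p  | yes q = split zero (suc zero)
      (λ { zero → inj₁ refl ; (suc zero) → inj₂ refl }) (≤-pred (≰⇒> p)) q
    ... | yes p | no q  = split (suc zero) zero
      (λ { zero → inj₂ refl ; (suc zero) → inj₁ refl }) (≤-pred (≰⇒> q)) p

-- Halving, and the capture time.

half-double : ∀ n → (n + n) / 2 ≡ n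
half-double n = trans (cong (_/ 2) (trans (cong (n +_) (sym (+-identityʳ n))) (*-comm 2 n))) (m*n/n≡m n 2)

half-suc-double : ∀ n → suc (n + n) / 2 ≡ n
half-suc-double n = trans (cong (λ m → suc m / 2) (trans (cong (n +_) (sym (+-identityʳ n))) (*-comm 2 n)))
  (trans (+-distrib-/-∣ʳ 1 {n * 2} {2} (n∣m*n n)) (m*n/n≡m n 2))

corollary3 : ∀ (m n : ℕ) → 2 ≤ m → 2 ≤ n →
    IsCaptureTime (Path m □ Path n) 2 ((m + n) / 2 ∸ 1)
corollary3 (suc (suc M)) (suc (suc N)) (s≤s (s≤s _)) (s≤s (s≤s _))
  with central {suc M} {suc N} (s≤s z≤n) (half (suc M)) (half (suc N))
-- T = 0 would make the sum of two positive numbers at most 1.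
... | zero , e , _ = ⊥-elim ([ (λ ()) , (λ e → 0≢1+n (trans (sym (suc-injective e)) (+-suc M N))) ]′ e)
... | suc T , e , start = subst (IsCaptureTime (Path (2 + M) □ Path (2 + N)) 2) (sym time)
    (central⇒cops-win start , optimal)
  where
  T′ = suc T
  shape : 2 + M + (2 + N) ≡ 2 + (suc M + suc N)
  shape = cong suc (+-suc (suc M) (suc N))
  time : (2 + M + (2 + N)) / 2 ∸ 1 ≡ T′
  time = cong (_∸ 1) (trans (cong (_/ 2) shape)
    ([ (λ e → trans (cong (λ n → (2 + n) / 2) e)
        (trans (cong (λ n → suc n / 2) (sym (+-suc T′ T′))) (half-double (suc T′))))
     , (λ e → trans (cong (λ n → (2 + n) / 2) e)
        (trans (cong (λ n → suc (suc n) / 2) (sym (+-suc T′ T′))) (half-suc-double (suc T′)))) ]′ e))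
  -- She must outlast T rounds, one fewer than the cops use, and 2T + 2 is twice `T′`.
  small : T + (2 + T) ≤ suc M + suc N
  small = ≤-trans (≤-reflexive (+-suc T T′))
    ([ (λ e → ≤-reflexive (sym e)) , (λ e → ≤-trans (n≤1+n _) (≤-reflexive (sym e))) ]′ e)
  optimal : ∀ s → Grid.CopsWinWithin (suc M) (suc N) s → T′ ≤ s
  optimal s (σ , wins) with T′ ≤? s
  ... | yes p = p
  ... | no p with Evader.escape M N T small σ
  ...   | ρ , escapes with wins ρ
  ...     | t , t≤s , captured = ⊥-elim (escapes t (≤-trans t≤s (≤-pred (≰⇒> p))) captured)
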